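{- For every connected graph $G$ with independence number $\alpha(G)$, $\varphi(G)\leq \hat{\varphi}(G)+\alpha(G)-1$.
   Context: All graphs are finite, simple and undirected, with at least one vertex. $\chi$ denotes the chromatic number. For a proper vertex coloring $c$ of $G$ and an induced subgraph $H$ of $G$, let $c(H)$ be the set of colors used by $c$ on the vertices of $H$. Define $\varphi_c(G)=\max_{H}\,(|c(H)|-\chi(H))$ over all induced subgraphs $H$ of $G$, and $\hat{\varphi}_c(G)$ as the same maximum taken only over all connected induced subgraphs $H$ of $G$. Define $\varphi(G)=\min_c \varphi_c(G)$ and $\hat{\varphi}(G)=\min_c \hat{\varphi}_c(G)$, the minima over all proper colorings $c$ of $G$ (with any number of colors). -}

module Defs where

open import Data.Nat.Base using (ℕ; zero; suc; _+_; _∸_; _^_; _≤_; _<_; s≤s⁻¹; NonZero)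
open import Data.Nat.Properties
  using (_≟_; _<?_; ≤-refl; ≤-trans; ≤-reflexive; ≤-antisym; ≤-total; ≮⇒≥; <-irrefl;
         <-≤-trans; m≤m+n; +-suc; +-monoʳ-≤)
open import Data.Fin.Base using (Fin; zero; suc; toℕ; funToFin; finToFun)
open import Data.Fin.Properties using (any?; all?; toℕ-injective; suc-injective; finToFun-funToFin)
open import Data.Fin.Subset
  using (Subset; inside; outside; _∈_; _∪_; ⁅_⁆; ⊤; ∣_∣; Nonempty)
  renaming (⊥ to ∅)
open import Data.Fin.Subset.Properties
  using (_∈?_; nonempty?; ∉⊥; x∈⁅x⁆; x∈⁅y⁆⇒x≡y; p⊆p∪q; q⊆p∪q; x∈p∪q⁻; ∣p∣≤n; p⊂q⇒∣p∣<∣q∣)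
open import Data.List.Base using ([]; _∷_; map; filter; deduplicate; length; allFin)
open import Data.List.Properties using (filter-≐; length-map)
open import Data.Vec.Base using ([]; _∷_)
open import Data.Product.Base using (∃; _×_; _,_; proj₁; proj₂)
open import Data.Sum.Base using (_⊎_; inj₁; inj₂; [_,_]′)
open import Data.Empty using (⊥-elim)
open import Function.Base using (_∘_)
open import Level using (0ℓ)
open import Relation.Binary.Core using (Rel)
open import Relation.Binary.Definitions using (Decidable)
open import Relation.Binary.Construct.Closure.ReflexiveTransitive using (Star; ε; _◅_; _◅◅_)
open import Relation.Binary.PropositionalEquality
  using (_≡_; _≢_; refl; sym; trans; cong; subst)
open import Relation.Nullary using (¬_; Dec; yes; no; ¬?; contradiction)
open import Relation.Nullary.Decidable using (_×-dec_; _→-dec_; map′; decidable-stable)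
import Relation.Unary as Unary

record Graph (n : ℕ) : Set₁ where
  infix 4 _~_ _~?_
  field
    _~_     : Rel (Fin n) 0ℓ
    _~?_    : Decidable _~_
    ~-sym   : ∀ {u v} → u ~ v → v ~ u
    ~-irrefl : ∀ {u} → ¬ u ~ u

-- min { f x ∣ P x } and max { f x ∣ P x }, given with an element attaining them.

record Minimum {X : Set} (P : X → Set) (f : X → ℕ) : Set where
  field
    arg   : X
    arg∈  : P arg
    least : ∀ {x} → P x → f arg ≤ f x

  value : ℕ
  value = f arg

record Maximum {X : Set} (P : X → Set) (f : X → ℕ) : Set where
  field
    arg      : X
    arg∈     : P arg
    greatest : ∀ {x} → P x → f x ≤ f arg

  value : ℕ
  value = f arg

-- A coloring may use arbitrary natural numbers as colors.
Coloring : ℕ → Set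
Coloring n = Fin n → ℕ

-- |c(S)|, the number of distinct colors of c on S.
#colors : ∀ {n} → Coloring n → Subset n → ℕ
#colors c S = length (deduplicate _≟_ (map c (filter (_∈? S) (allFin _))))

-- An induced subgraph is represented by its vertex set S; S = ⊤ gives G itself.

module _ {n : ℕ} (G : Graph n) where
  open Graph G

  -- The restriction of c to S is a proper coloring of the subgraph induced by S.
  Proper : Subset n → Coloring n → Set
  Proper S c = ∀ u v → u ∈ S → v ∈ S → u ~ v → c u ≢ c v

  EdgeWithin : Subset n → Rel (Fin n) 0ℓ
  EdgeWithin S u v = u ∈ S × v ∈ S × u ~ v

  Connected : Subset n → Set
  Connected S = Nonempty S × (∀ u v → u ∈ S → v ∈ S → Star (EdgeWithin S) u v)

  Independent : Subset n → Set
  Independent S = ∀ u v → u ∈ S → v ∈ S → ¬ u ~ v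

-- The remainder up to χ-min shows that the minima and maxima used below exist.

private

  open Maximum

  maximumAt : ∀ {n} {P : Subset (suc n) → Set} {f : Subset (suc n) → ℕ} {S} → P S →
              (∀ {T} → P (outside ∷ T) → f (outside ∷ T) ≤ f S) →
              (∀ {T} → P (inside ∷ T) → f (inside ∷ T) ≤ f S) → Maximum P f
  maximumAt {S = S} p o i = record
    { arg = S ; arg∈ = p ; greatest = λ { {outside ∷ _} → o ; {inside ∷ _} → i } }

  maximum : ∀ {n} {P : Subset n → Set} → Unary.Decidable P → (f : Subset n → ℕ) →
            (∀ S → ¬ P S) ⊎ Maximum P f
  maximum {zero} P? f with P? []
  ... | yes p = inj₂ (record { arg = [] ; arg∈ = p ; greatest = λ { {[]} _ → ≤-refl } })
  ... | no ¬p = inj₁ λ { [] → ¬p }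
  maximum {suc n} P? f
    with maximum (P? ∘ (outside ∷_)) (f ∘ (outside ∷_)) | maximum (P? ∘ (inside ∷_)) (f ∘ (inside ∷_))
  ... | inj₁ ¬o | inj₁ ¬i = inj₁ λ { (outside ∷ S) → ¬o S ; (inside ∷ S) → ¬i S }
  ... | inj₁ ¬o | inj₂ i = inj₂ (maximumAt (arg∈ i) (λ p → contradiction p (¬o _)) (greatest i))
  ... | inj₂ o | inj₁ ¬i = inj₂ (maximumAt (arg∈ o) (greatest o) (λ p → contradiction p (¬i _)))
  ... | inj₂ o | inj₂ i with ≤-total (value o) (value i)
  ...   | inj₁ o≤i = inj₂ (maximumAt (arg∈ i) (λ p → ≤-trans (greatest o p) o≤i) (greatest i))
  ...   | inj₂ i≤o = inj₂ (maximumAt (arg∈ o) (greatest o) (λ p → ≤-trans (greatest i p) i≤o))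

  maximum⁺ : ∀ {n} {P : Subset n → Set} → Unary.Decidable P → (f : Subset n → ℕ) →
             ∃ P → Maximum P f
  maximum⁺ P? f (S , p) = [ (λ ¬P → contradiction p (¬P S)) , (λ m → m) ]′ (maximum P? f)

  -- Two colorings with the same color classes.
  infix 4 _≈_
  _≈_ : ∀ {n} → Coloring n → Coloring n → Set
  c ≈ d = ∀ u v → (c u ≡ c v → d u ≡ d v) × (d u ≡ d v → c u ≡ c v)

  ≈-sym : ∀ {n} {c d : Coloring n} → c ≈ d → d ≈ c
  ≈-sym e u v = proj₂ (e u v) , proj₁ (e u v)

  -- Up to ≈, suc n colors suffice, so that there are finitely many cases.
  module _ {n : ℕ} (c : Coloring n) where

    representative : ℕ → Fin (suc n)
    representative x with any? (λ w → c w ≟ x)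
    ... | yes (w , _) = suc w
    ... | no _        = zero

    representative-correct : ∀ v → ∃ λ w → representative (c v) ≡ suc w × c w ≡ c v
    representative-correct v with any? (λ w → c w ≟ c v)
    ... | yes (w , e) = w , refl , e
    ... | no ¬e       = contradiction (v , refl) ¬e

    code : Fin (suc n ^ n)
    code = funToFin (representative ∘ c)

  decode : ∀ {n} → Fin (suc n ^ n) → Coloring n
  decode i v = toℕ (finToFun i v)

  decode-code : ∀ {n} (c : Coloring n) → c ≈ decode (code c)
  decode-code c u v = to , from
    where
    d = finToFun-funToFin (representative c ∘ c)
    to : c u ≡ c v → decode (code c) u ≡ decode (code c) v
    to e = cong toℕ (trans (d u) (trans (cong (representative c) e) (sym (d v))))
    from : decode (code c) u ≡ decode (code c) v → c u ≡ c v
    from e with representative-correct c u | representative-correct c v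
    ... | w , p , q | w′ , p′ , q′ =
      trans (sym q) (trans (cong c (suc-injective
        (trans (sym p) (trans (trans (sym (d u)) (trans (toℕ-injective e) (d v))) p′)))) q′)

  someColoring? : ∀ {n} {P : Coloring n → Set} → (∀ {c d} → c ≈ d → P c → P d) →
                  Unary.Decidable P → Dec (∃ P)
  someColoring? P-resp P? =
    map′ (λ (i , p) → decode i , p) (λ (c , p) → code c , P-resp (decode-code c) p)
         (any? (P? ∘ decode))

  minimum : ∀ {n} {P : Coloring n → Set} {f : Coloring n → ℕ} →
            (∀ {c d} → c ≈ d → P c → P d) → (∀ {c d} → c ≈ d → f c ≡ f d) →
            Unary.Decidable P → ∃ P → Minimum P f
  minimum {P = P} {f} P-resp f-resp P? (c₀ , p₀) = go (suc (f c₀)) c₀ p₀ ≤-refl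
    where
    go : ∀ k c → P c → f c < k → Minimum P f
    go (suc k) c p fc<k
      with someColoring? (λ e (q , l) → P-resp e q , subst (_< f c) (f-resp e) l)
                         (λ d → P? d ×-dec f d <? f c)
    ... | yes (d , q , fd<fc) = go k d q (<-≤-trans fd<fc (s≤s⁻¹ fc<k))
    ... | no ¬smaller = record
      { arg = c ; arg∈ = p ; least = λ {d} q → ≮⇒≥ λ l → ¬smaller (d , q , l) }

  filter-map : ∀ {A : Set} (c : A → ℕ) {P : ℕ → Set} (P? : Unary.Decidable P) xs →
               filter P? (map c xs) ≡ map c (filter (P? ∘ c) xs)
  filter-map c P? [] = refl
  filter-map c P? (x ∷ xs) with P? (c x)
  ... | yes _ = cong (c x ∷_) (filter-map c P? xs)
  ... | no  _ = filter-map c P? xs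

  deduplicate-map : ∀ {A : Set} (c : A → ℕ) xs →
                    deduplicate _≟_ (map c xs) ≡ map c (deduplicate (λ u v → c u ≟ c v) xs)
  deduplicate-map c [] = refl
  deduplicate-map c (x ∷ xs) = cong (c x ∷_)
    (trans (cong (filter _) (deduplicate-map c xs)) (filter-map c _ (deduplicate _ xs)))

  deduplicate-≈ : ∀ {n} {c d : Coloring n} → c ≈ d → ∀ xs →
                  deduplicate (λ u v → c u ≟ c v) xs ≡ deduplicate (λ u v → d u ≟ d v) xs
  deduplicate-≈ e [] = refl
  deduplicate-≈ {c = c} {d} e (x ∷ xs) = cong (x ∷_)
    (trans (cong (filter _) (deduplicate-≈ e xs))
           (filter-≐ (λ y → ¬? (c x ≟ c y)) (λ y → ¬? (d x ≟ d y))
                     ((λ ¬p → ¬p ∘ proj₂ (e x _)) , (λ ¬p → ¬p ∘ proj₁ (e x _)))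
                     (deduplicate (λ u v → d u ≟ d v) xs)))

  #colors-≈ : ∀ {n} {c d : Coloring n} (S : Subset n) → c ≈ d → #colors c S ≡ #colors d S
  #colors-≈ {c = c} {d} S e = trans (lem c) (trans (cong length (deduplicate-≈ e vs)) (sym (lem d)))
    where
    vs = filter (_∈? S) (allFin _)
    lem : ∀ c → #colors c S ≡ length (deduplicate (λ u v → c u ≟ c v) vs)
    lem c = trans (cong length (deduplicate-map c vs)) (length-map c (deduplicate (λ u v → c u ≟ c v) vs))

  module _ {n : ℕ} {R : Rel (Fin n) 0ℓ} (R? : Decidable R) (u : Fin n) where

    -- The set of vertices reachable from u, by adding one vertex at a time.
    reachable : ∀ k (T : Subset n) → n ≤ k + ∣ T ∣ → u ∈ T → (∀ v → v ∈ T → Star R u v) →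
                ∃ λ T → u ∈ T × (∀ v → v ∈ T → Star R u v) × (∀ {x y} → R x y → x ∈ T → y ∈ T)
    reachable k T n≤ u∈T sound
      with any? (λ x → any? (λ y → x ∈? T ×-dec ¬? (y ∈? T) ×-dec R? x y))
    ... | no ¬exit = T , u∈T , sound , λ {x} {y} r x∈T →
            decidable-stable (y ∈? T) (λ y∉T → ¬exit (x , y , x∈T , y∉T , r))
    ... | yes (x , y , x∈T , y∉T , r) = add k n≤
      where
      T′ = T ∪ ⁅ y ⁆
      bigger : ∣ T ∣ < ∣ T′ ∣
      bigger = p⊂q⇒∣p∣<∣q∣ (p⊆p∪q ⁅ y ⁆ , y , q⊆p∪q T ⁅ y ⁆ (x∈⁅x⁆ y) , y∉T)
      sound′ : ∀ v → v ∈ T′ → Star R u v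
      sound′ v v∈ with x∈p∪q⁻ T ⁅ y ⁆ v∈
      ... | inj₁ v∈T = sound v v∈T
      ... | inj₂ v∈y = subst (Star R u) (sym (x∈⁅y⁆⇒x≡y y v∈y)) (sound x x∈T ◅◅ r ◅ ε)
      add : ∀ k → n ≤ k + ∣ T ∣ → _
      add zero    n≤ = contradiction (<-≤-trans bigger (≤-trans (∣p∣≤n T′) n≤)) (<-irrefl refl)
      add (suc k) n≤ = reachable k T′
        (≤-trans n≤ (≤-trans (≤-reflexive (sym (+-suc k ∣ T ∣)))
                             (+-monoʳ-≤ k bigger)))
        (p⊆p∪q ⁅ y ⁆ u∈T) sound′

    star? : ∀ v → Dec (Star R u v)
    star? v with reachable n ⁅ u ⁆ (m≤m+n n _) (x∈⁅x⁆ u)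
                           (λ v v∈u → subst (Star R u) (sym (x∈⁅y⁆⇒x≡y u v∈u)) ε)
    ... | T , u∈T , sound , closed = map′ (sound v) (λ s → follow s u∈T) (v ∈? T)
      where
      follow : ∀ {x y} → Star R x y → x ∈ T → y ∈ T
      follow ε       x∈T = x∈T
      follow (r ◅ s) x∈T = follow s (closed r x∈T)

  someVertex : ∀ {n} → .⦃ NonZero n ⦄ → Fin n
  someVertex {suc n} = zero

module _ {n : ℕ} (G : Graph n) where
  open Graph G

  private
    proper? : ∀ S → Unary.Decidable (Proper G S)
    proper? S c = all? λ u → all? λ v →
      u ∈? S →-dec (v ∈? S →-dec (u ~? v →-dec ¬? (c u ≟ c v)))

    proper-≈ : ∀ S {c d} → c ≈ d → Proper G S c → Proper G S d
    proper-≈ S e p u v u∈ v∈ u~v = p u v u∈ v∈ u~v ∘ proj₂ (e u v)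

    someProper : ∀ S → ∃ (Proper G S)
    someProper S = toℕ , λ u v _ _ u~v e →
      ~-irrefl (subst (u ~_) (sym (toℕ-injective e)) u~v)

    connected? : Unary.Decidable (Connected G)
    connected? S = nonempty? S ×-dec all? λ u → all? λ v → u ∈? S →-dec (v ∈? S →-dec
      star? (λ u v → u ∈? S ×-dec v ∈? S ×-dec u ~? v) u v)

    independent? : Unary.Decidable (Independent G)
    independent? S = all? λ u → all? λ v → u ∈? S →-dec (v ∈? S →-dec ¬? (u ~? v))

    connected-singleton : ∀ u → Connected G ⁅ u ⁆
    connected-singleton u = (u , x∈⁅x⁆ u) , λ v w v∈ w∈ →
      subst (Star _ v) (trans (x∈⁅y⁆⇒x≡y u v∈) (sym (x∈⁅y⁆⇒x≡y u w∈))) ε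

  χ-min : ∀ S → Minimum (Proper G S) (λ c → #colors c S)
  χ-min S = minimum (proper-≈ S) (#colors-≈ S) (proper? S) (someProper S)

  -- The chromatic number of the subgraph induced by S.
  χ : Subset n → ℕ
  χ S = Minimum.value (χ-min S)

  α-max : Maximum (Independent G) ∣_∣
  α-max = maximum⁺ independent? ∣_∣ (∅ , λ u v u∈ → ⊥-elim (∉⊥ u∈))

  α : ℕ
  α = Maximum.value α-max

  -- Truncated subtraction is exact here for proper c, as then χ S ≤ #colors c S.
  excess : Coloring n → Subset n → ℕ
  excess c S = #colors c S ∸ χ S

  module _ .⦃ _ : NonZero n ⦄ where

    φ-max : ∀ c → Maximum Nonempty (excess c)
    φ-max c = maximum⁺ nonempty? (excess c) (⁅ someVertex ⁆ , someVertex , x∈⁅x⁆ someVertex)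

    φ̂-max : ∀ c → Maximum (Connected G) (excess c)
    φ̂-max c = maximum⁺ connected? (excess c) (⁅ someVertex ⁆ , connected-singleton someVertex)

    φ[_] : Coloring n → ℕ
    φ[ c ] = Maximum.value (φ-max c)

    φ̂[_] : Coloring n → ℕ
    φ̂[ c ] = Maximum.value (φ̂-max c)

    private
      max-≈ : ∀ {P : Subset n → Set} (m : ∀ c → Maximum P (excess c)) {c d} → c ≈ d →
              Maximum.value (m c) ≡ Maximum.value (m d)
      max-≈ m e = ≤-antisym (half e) (half (≈-sym e))
        where
        half : ∀ {c d} → c ≈ d → Maximum.value (m c) ≤ Maximum.value (m d)
        half {c} {d} e = ≤-trans
          (≤-reflexive (cong (_∸ χ (Maximum.arg (m c))) (#colors-≈ (Maximum.arg (m c)) e)))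
          (Maximum.greatest (m d) (Maximum.arg∈ (m c)))

    φ-min : Minimum (Proper G ⊤) φ[_]
    φ-min = minimum (proper-≈ ⊤) (max-≈ φ-max) (proper? ⊤) (someProper ⊤)

    φ̂-min : Minimum (Proper G ⊤) φ̂[_]
    φ̂-min = minimum (proper-≈ ⊤) (max-≈ φ̂-max) (proper? ⊤) (someProper ⊤)

    φ : ℕ
    φ = Minimum.value φ-min

    φ̂ : ℕ
    φ̂ = Minimum.value φ̂-min

{-# OPTIONS --safe #-}

-- Let c attain φ̂ and let H attain φ[ c ].  It suffices to enlarge H to a connected induced
-- subgraph whose chromatic number exceeds that of H by at most α − 1, since enlarging H loses
-- no color of c.  Adding vertices without neighbors in H does not change χ, so H may be taken
-- dominating.  The components of the members of a maximal independent set of H then cover H by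
-- at most α connected pieces.  While there is more than one piece, let X be the first and Y the
-- union of the others.  Since G is connected and H is dominating, either some vertex w is near
-- both X and Y, or there is an edge uv with u near X only and v near Y only.  Adding w, or u
-- and v, merges X with another piece, and one new color always suffices.
module Submission where

open import Defs
open import Data.Nat.Base using (ℕ; zero; suc; _+_; _∸_; _≤_; _<_; z≤n; s≤s; z<s; NonZero)
open import Data.Nat.Properties
  using (_≟_; ≤-trans; ≤-reflexive; ≤-<-trans; <-≤-trans; <-irrefl; <⇒≢; n<1+n; m<n⇒m<1+n; m≤m+n;
         suc-injective; +-suc; +-comm; +-assoc; +-∸-assoc; +-monoˡ-≤; +-monoʳ-≤; ∸-monoˡ-≤;
         m≤n+o⇒m∸n≤o; m≤n+m∸n; module ≤-Reasoning)
open import Data.Fin.Base using (Fin; zero; suc; toℕ)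
open import Data.Fin.Properties using (any?; toℕ<n; toℕ-injective)
  renaming (_≟_ to _≟ꟳ_)
open import Data.Fin.Subset
  using (Subset; inside; outside; _∈_; _⊆_; _∪_; ⁅_⁆; ⊤; ∣_∣; Nonempty; ⋃)
open import Data.Fin.Subset.Properties
  using (_∈?_; ∈⊤; ∉⊥; x∈⁅x⁆; x∈⁅y⁆⇒x≡y; p⊆p∪q; q⊆p∪q; x∈p∪q⁻; x∈p∪q⁺; ∣p∣≤n; p⊂q⇒∣p∣<∣q∣;
         ∣⁅x⁆∣≡1)
open import Data.List.Base
  using (List; []; _∷_; _++_; map; length; filter; deduplicate; allFin)
open import Data.List.Properties using (length-++-sucʳ; length-map; length-upTo)
open import Data.List.Membership.Propositional using () renaming (_∈_ to _∈ᴸ_)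
open import Data.List.Membership.Propositional.Properties
  using (∈-∃++; ∈-++⁻; ∈-++⁺ˡ; ∈-++⁺ʳ; ∈-map⁺; ∈-map⁻; ∈-filter⁺; ∈-filter⁻; ∈-allFin; ∈-upTo⁺;
         ∈-deduplicate⁺; ∈-deduplicate⁻)
import Data.List.Membership.DecPropositional as DecMembership
open import Data.List.Membership.Setoid.Properties using (index-injective)
open import Data.List.Relation.Binary.Subset.Propositional using () renaming (_⊆_ to _⊆ᴸ_)
open import Data.List.Relation.Unary.All as All using ([]; _∷_)
open import Data.List.Relation.Unary.Any using (here; there; index)
open import Data.List.Relation.Unary.AllPairs using ([]; _∷_)
open import Data.List.Relation.Unary.Unique.Propositional using (Unique)
open import Data.List.Relation.Unary.Unique.DecPropositional.Properties _≟_ using (deduplicate-!)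
open import Data.Vec.Base using ([]; _∷_; here; there)
open import Data.Vec.Functional using (updateAt)
open import Data.Vec.Functional.Properties using (updateAt-updates; updateAt-minimal)
open import Data.Product.Base using (∃; ∃₂; _×_; _,_; proj₁; proj₂)
open import Data.Sum.Base using (_⊎_; inj₁; inj₂; [_,_]′)
open import Function.Base using (_∘_; const; case_of_)
open import Relation.Binary.Construct.Closure.ReflexiveTransitive as Star
  using (Star; ε; _◅_; _◅◅_)
open import Relation.Binary.PropositionalEquality
  using (_≡_; _≢_; refl; sym; trans; cong; subst; setoid)
open import Relation.Nullary using (¬_; Dec; yes; no; ¬?; contradiction)
open import Relation.Nullary.Decidable using (_×-dec_; _⊎-dec_; decidable-stable)

-- Duplicate-free lists

module _ {A : Set} where

  ∈-++-∷⁻ : ∀ {x y : A} xs {ys} → x ∈ᴸ xs ++ y ∷ ys → x ≡ y ⊎ x ∈ᴸ xs ++ ys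
  ∈-++-∷⁻ xs x∈ with ∈-++⁻ xs x∈
  ... | inj₁ x∈xs         = inj₂ (∈-++⁺ˡ x∈xs)
  ... | inj₂ (here x≡y)   = inj₁ x≡y
  ... | inj₂ (there x∈ys) = inj₂ (∈-++⁺ʳ xs x∈ys)

  ∈-++-∷⁺ : ∀ {x y : A} xs {ys} → x ∈ᴸ xs ++ ys → x ∈ᴸ xs ++ y ∷ ys
  ∈-++-∷⁺ xs x∈ = [ ∈-++⁺ˡ , ∈-++⁺ʳ xs ∘ there ]′ (∈-++⁻ xs x∈)

  -- The occurrence of the head in `ys` is cut out; by uniqueness the tail stays within what
  -- remains.
  unique-⊆⇒length≤ : ∀ {xs ys : List A} → Unique xs → xs ⊆ᴸ ys → length xs ≤ length ys
  unique-⊆⇒length≤ [] _ = z≤n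
  unique-⊆⇒length≤ {x ∷ xs} (x∉xs ∷ xs!) xs⊆ys with ∈-∃++ (xs⊆ys (here refl))
  ... | as , bs , refl = ≤-trans
    (s≤s (unique-⊆⇒length≤ xs! λ z∈xs →
      [ (λ z≡x → contradiction (sym z≡x) (All.lookup x∉xs z∈xs)) , (λ z∈ → z∈) ]′
        (∈-++-∷⁻ as (xs⊆ys (there z∈xs)))))
    (≤-reflexive (sym (length-++-sucʳ as x bs)))

-- Finite subsets

elements : ∀ {n} (S : Subset n) →
           ∃ λ xs → length xs ≡ ∣ S ∣ × (∀ {x} → x ∈ S → x ∈ᴸ xs) × (∀ {x} → x ∈ᴸ xs → x ∈ S)
elements [] = [] , refl , (λ ()) , λ ()
elements (outside ∷ S) with elements S
... | xs , len , S⊆xs , xs⊆S =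
  map suc xs , trans (length-map suc xs) len
  , (λ { (there x∈) → ∈-map⁺ suc (S⊆xs x∈) })
  , λ x∈ → let _ , y∈ , eq = ∈-map⁻ suc x∈ in subst (_∈ _) (sym eq) (there (xs⊆S y∈))
elements (inside ∷ S) with elements S
... | xs , len , S⊆xs , xs⊆S =
  zero ∷ map suc xs , cong suc (trans (length-map suc xs) len)
  , (λ { here → here refl ; (there x∈) → there (∈-map⁺ suc (S⊆xs x∈)) })
  , λ { (here refl) → here
      ; (there x∈) → let _ , y∈ , eq = ∈-map⁻ suc x∈ in subst (_∈ _) (sym eq) (there (xs⊆S y∈)) }

module _ {n : ℕ} where

  x∈⋃⁺ : ∀ {x : Fin n} {S Ss} → S ∈ᴸ Ss → x ∈ S → x ∈ ⋃ Ss
  x∈⋃⁺ (here refl) x∈S = x∈p∪q⁺ (inj₁ x∈S)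
  x∈⋃⁺ (there S∈)  x∈S = x∈p∪q⁺ (inj₂ (x∈⋃⁺ S∈ x∈S))

  x∈⋃⁻ : ∀ {x : Fin n} Ss → x ∈ ⋃ Ss → ∃ λ S → S ∈ᴸ Ss × x ∈ S
  x∈⋃⁻ []       x∈ = contradiction x∈ ∉⊥
  x∈⋃⁻ (S ∷ Ss) x∈ with x∈p∪q⁻ S (⋃ Ss) x∈
  ... | inj₁ x∈S  = S , here refl , x∈S
  ... | inj₂ x∈Ss = let T , T∈ , x∈T = x∈⋃⁻ Ss x∈Ss in T , there T∈ , x∈T

  ∪-least : ∀ {S T U : Subset n} → S ⊆ U → T ⊆ U → S ∪ T ⊆ U
  ∪-least S⊆U T⊆U = [ S⊆U , T⊆U ]′ ∘ x∈p∪q⁻ _ _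

  ⁅⁆⊆ : ∀ {x : Fin n} {S} → x ∈ S → ⁅ x ⁆ ⊆ S
  ⁅⁆⊆ x∈S y∈ = subst (_∈ _) (sym (x∈⁅y⁆⇒x≡y _ y∈)) x∈S

  updateAt-∪⁅⁆ : ∀ {S} {c : Coloring n} {k w x} → x ∈ S ∪ ⁅ w ⁆ → let c′ = updateAt c w (const k) in
                 x ≡ w × c′ x ≡ k ⊎ x ∈ S × c′ x ≡ c x
  updateAt-∪⁅⁆ {S} {c} {_} {w} {x} x∈ with x ≟ꟳ w | x∈p∪q⁻ S ⁅ w ⁆ x∈
  ... | yes refl | _        = inj₁ (refl , updateAt-updates x c)
  ... | no x≢w   | inj₁ x∈S = inj₂ (x∈S , updateAt-minimal x w c x≢w)
  ... | no x≢w   | inj₂ x∈w = contradiction (x∈⁅y⁆⇒x≡y w x∈w) x≢w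

  -- Greedy growth: elements satisfying `R` are added one at a time until no new one is left. It
  -- yields components, maximal independent sets and dominating supersets below.
  saturate : ∀ {P : Subset n → Set} {R : Subset n → Fin n → Set} →
             (∀ S x → Dec (R S x)) → (∀ {S x} → P S → R S x → P (S ∪ ⁅ x ⁆)) →
             ∀ {S} → P S → ∃ λ T → P T × (∀ {x} → R T x → x ∈ T)
  saturate {P} {R} R? extend {S} = go n S (m≤m+n n _)
    where
    go : ∀ k S → n ≤ k + ∣ S ∣ → P S → ∃ λ T → P T × (∀ {x} → R T x → x ∈ T)
    go k S n≤ p with any? (λ x → ¬? (x ∈? S) ×-dec R? S x)
    ... | no ¬new = S , p , λ {x} r → decidable-stable (x ∈? S) (λ x∉S → ¬new (x , x∉S , r))
    ... | yes (x , x∉S , r) = add k n≤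
      where
      bigger : ∣ S ∣ < ∣ S ∪ ⁅ x ⁆ ∣
      bigger = p⊂q⇒∣p∣<∣q∣ (p⊆p∪q ⁅ x ⁆ , x , q⊆p∪q S ⁅ x ⁆ (x∈⁅x⁆ x) , x∉S)
      add : ∀ k → n ≤ k + ∣ S ∣ → _
      -- With `k` exhausted, `S` already has `n` elements and cannot grow.
      add zero    n≤ = contradiction (≤-trans bigger (≤-trans (∣p∣≤n (S ∪ ⁅ x ⁆)) n≤))
                                     (<-irrefl refl)
      add (suc k) n≤ = go k (S ∪ ⁅ x ⁆)
        (≤-trans n≤ (≤-trans (≤-reflexive (sym (+-suc k ∣ S ∣))) (+-monoʳ-≤ k bigger)))
        (extend p r)

-- Numbers of colors

module _ {n : ℕ} where

  colors : Coloring n → Subset n → List ℕ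
  colors c S = deduplicate _≟_ (map c (filter (_∈? S) (allFin n)))

  ∈-colors⁺ : ∀ c {S v} → v ∈ S → c v ∈ᴸ colors c S
  ∈-colors⁺ c {S} {v} v∈S = ∈-deduplicate⁺ _≟_ (∈-map⁺ c (∈-filter⁺ (_∈? S) (∈-allFin v) v∈S))

  ∈-colors⁻ : ∀ c {S x} → x ∈ᴸ colors c S → ∃ λ v → v ∈ S × x ≡ c v
  ∈-colors⁻ c {S} x∈ with ∈-map⁻ c (∈-deduplicate⁻ _≟_ _ x∈)
  ... | v , v∈ , eq = v , proj₂ (∈-filter⁻ (_∈? S) {xs = allFin n} v∈) , eq

  #colors-least : ∀ c {S xs} → (∀ {v} → v ∈ S → c v ∈ᴸ xs) → #colors c S ≤ length xs
  #colors-least c cS⊆xs = unique-⊆⇒length≤ (deduplicate-! _) λ x∈ →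
    let _ , v∈S , eq = ∈-colors⁻ c x∈ in subst (_∈ᴸ _) (sym eq) (cS⊆xs v∈S)

  #colors-mono : ∀ c {S T} → S ⊆ T → #colors c S ≤ #colors c T
  #colors-mono c S⊆T = #colors-least c (∈-colors⁺ c ∘ S⊆T)

module _ {n : ℕ} (G : Graph n) where
  open Graph G

  -- Bounding the colors, rather than counting them, makes `q` a fresh color and, for positive `q`,
  -- 0 an available one.
  Colorable : Subset n → ℕ → Set
  Colorable S q = ∃ λ c → Proper G S c × (∀ {x} → x ∈ S → c x < q)

  Colorable-anti : ∀ {S T q} → S ⊆ T → Colorable T q → Colorable S q
  Colorable-anti S⊆T (c , p , b) = c , (λ u v u∈ v∈ → p u v (S⊆T u∈) (S⊆T v∈)) , b ∘ S⊆T

  Colorable⇒χ≤ : ∀ {S q} → Colorable S q → χ G S ≤ q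
  Colorable⇒χ≤ {S} {q} (c , p , b) = ≤-trans (Minimum.least (χ-min G S) p)
    (≤-trans (#colors-least c (∈-upTo⁺ ∘ b)) (≤-reflexive (length-upTo q)))

  -- Each color is renamed to its index in the duplicate-free list of colors on `S`; equal indices
  -- force equal colors.
  proper⇒Colorable : ∀ {S} c → Proper G S c → Colorable S (#colors c S)
  proper⇒Colorable {S} c p = d , d-proper , d-bounded
    where
    open DecMembership _≟_ using () renaming (_∈?_ to _∈ᴸ?_)
    position : ∀ {x} → Dec (x ∈ᴸ colors c S) → ℕ
    position (yes x∈) = toℕ (index x∈)
    -- Default for a color absent from `S`; no vertex of `S` receives it this way.
    position (no _)   = 0
    d : Coloring n
    d v = position (c v ∈ᴸ? colors c S)
    d-proper : Proper G S d
    d-proper u v u∈ v∈ u~v du≡dv with c u ∈ᴸ? colors c S | c v ∈ᴸ? colors c S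
    ... | yes cu∈ | yes cv∈ =
      p u v u∈ v∈ u~v (index-injective (setoid ℕ) cu∈ cv∈ (toℕ-injective du≡dv))
    ... | yes _   | no cv∉  = cv∉ (∈-colors⁺ c v∈)
    ... | no cu∉  | _       = cu∉ (∈-colors⁺ c u∈)
    d-bounded : ∀ {v} → v ∈ S → d v < #colors c S
    d-bounded {v} v∈ with c v ∈ᴸ? colors c S
    ... | yes cv∈ = toℕ<n (index cv∈)
    ... | no cv∉  = contradiction (∈-colors⁺ c v∈) cv∉

  χ-Colorable : ∀ S → Colorable S (χ G S)
  χ-Colorable S = proper⇒Colorable (Minimum.arg (χ-min G S)) (Minimum.arg∈ (χ-min G S))

  -- Closed neighborhoods and domination

  Near : Subset n → Fin n → Set
  Near S x = x ∈ S ⊎ ∃ λ y → y ∈ S × y ~ x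

  near? : ∀ S x → Dec (Near S x)
  near? S x = x ∈? S ⊎-dec any? (λ y → y ∈? S ×-dec y ~? x)

  near-mono : ∀ {S T x} → S ⊆ T → Near S x → Near T x
  near-mono S⊆T (inj₁ x∈S)             = inj₁ (S⊆T x∈S)
  near-mono S⊆T (inj₂ (y , y∈S , y~x)) = inj₂ (y , S⊆T y∈S , y~x)

  near-⋃⁻ : ∀ Ss {x} → Near (⋃ Ss) x → ∃ λ S → S ∈ᴸ Ss × Near S x
  near-⋃⁻ Ss (inj₁ x∈) =
    let S , S∈ , x∈S = x∈⋃⁻ Ss x∈ in S , S∈ , inj₁ x∈S
  near-⋃⁻ Ss (inj₂ (y , y∈ , y~x)) =
    let S , S∈ , y∈S = x∈⋃⁻ Ss y∈ in S , S∈ , inj₂ (y , y∈S , y~x)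

  Dominating : Subset n → Set
  Dominating S = ∀ x → Near S x

  -- Connectedness

  edgeWithin-mono : ∀ {S T} → S ⊆ T → ∀ {u v} → EdgeWithin G S u v → EdgeWithin G T u v
  edgeWithin-mono S⊆T (u∈ , v∈ , u~v) = S⊆T u∈ , S⊆T v∈ , u~v

  connected-⁅⁆ : ∀ x → Connected G ⁅ x ⁆
  connected-⁅⁆ x = (x , x∈⁅x⁆ x) , λ u v u∈ v∈ →
    subst (Star _ u) (trans (x∈⁅y⁆⇒x≡y x u∈) (sym (x∈⁅y⁆⇒x≡y x v∈))) ε

  connected-hub : ∀ {S} x → x ∈ S →
                  (∀ {u} → u ∈ S → Star (EdgeWithin G S) u x × Star (EdgeWithin G S) x u) →
                  Connected G S
  connected-hub x x∈S s = (x , x∈S) , λ u v u∈ v∈ → proj₁ (s u∈) ◅◅ proj₂ (s v∈)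

  connected-∪ : ∀ {S T x} → Connected G S → Connected G T → x ∈ S → x ∈ T → Connected G (S ∪ T)
  connected-∪ {S} {T} {x} (_ , S-conn) (_ , T-conn) x∈S x∈T =
    connected-hub x (p⊆p∪q T x∈S) λ {u} u∈ → case x∈p∪q⁻ S T u∈ of λ
      { (inj₁ u∈S) → inS (S-conn u x u∈S x∈S) , inS (S-conn x u x∈S u∈S)
      ; (inj₂ u∈T) → inT (T-conn u x u∈T x∈T) , inT (T-conn x u x∈T u∈T) }
    where
    inS : ∀ {u v} → Star (EdgeWithin G S) u v → Star (EdgeWithin G (S ∪ T)) u v
    inS = Star.map (edgeWithin-mono (p⊆p∪q T))
    inT : ∀ {u v} → Star (EdgeWithin G T) u v → Star (EdgeWithin G (S ∪ T)) u v
    inT = Star.map (edgeWithin-mono (q⊆p∪q S T))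

  connected-edge : ∀ {x y} → x ~ y → Connected G (⁅ x ⁆ ∪ ⁅ y ⁆)
  connected-edge {x} {y} x~y = connected-hub x x∈ λ u∈ →
    [ (λ u∈x → subst both (sym (x∈⁅y⁆⇒x≡y x u∈x)) (ε , ε))
    , (λ u∈y → subst both (sym (x∈⁅y⁆⇒x≡y y u∈y))
                 ((y∈ , x∈ , ~-sym x~y) ◅ ε , (x∈ , y∈ , x~y) ◅ ε)) ]′ (x∈p∪q⁻ ⁅ x ⁆ ⁅ y ⁆ u∈)
    where
    S = ⁅ x ⁆ ∪ ⁅ y ⁆
    both : Fin n → Set
    both u = Star (EdgeWithin G S) u x × Star (EdgeWithin G S) x u
    x∈ : x ∈ S
    x∈ = p⊆p∪q ⁅ y ⁆ (x∈⁅x⁆ x)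
    y∈ : y ∈ S
    y∈ = q⊆p∪q ⁅ x ⁆ ⁅ y ⁆ (x∈⁅x⁆ y)

  connected-resp : ∀ {S T} → S ⊆ T → T ⊆ S → Connected G S → Connected G T
  connected-resp S⊆T T⊆S ((x , x∈) , conn) =
    (x , S⊆T x∈) , λ u v u∈ v∈ → Star.map (edgeWithin-mono S⊆T) (conn u v (T⊆S u∈) (T⊆S v∈))

  connected-near : ∀ {S x} → Connected G S → Near S x → Connected G (S ∪ ⁅ x ⁆)
  connected-near {x = x} S-conn (inj₁ x∈S) = connected-∪ S-conn (connected-⁅⁆ x) x∈S (x∈⁅x⁆ x)
  connected-near {S} {x} S-conn (inj₂ (y , y∈S , y~x)) =
    -- The edge from `y` to `x` is glued to `S` at `y`; since `y` is in `S`, only `x` is new.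
    connected-resp (∪-least (p⊆p∪q ⁅ x ⁆) (∪-least (⁅⁆⊆ (p⊆p∪q ⁅ x ⁆ y∈S)) (q⊆p∪q S ⁅ x ⁆)))
                   (∪-least (p⊆p∪q _) (q⊆p∪q S _ ∘ q⊆p∪q ⁅ y ⁆ ⁅ x ⁆))
      (connected-∪ S-conn (connected-edge y~x) y∈S (p⊆p∪q ⁅ x ⁆ (x∈⁅x⁆ y)))

  -- `T` is grown from `r` inside `S`. Of its maximality only the absorption of the neighbors of `r`
  -- is recorded: this is what lets the components of a dominating set of vertices cover `S`.
  component : ∀ S {r} → r ∈ S →
              ∃ λ T → Connected G T × T ⊆ S × (∀ {x} → x ∈ S → Near ⁅ r ⁆ x → x ∈ T)
  component S {r} r∈S
    with saturate {P = λ T → r ∈ T × Connected G T × T ⊆ S} {R = λ T x → x ∈ S × Near T x}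
                  (λ T x → x ∈? S ×-dec near? T x)
                  (λ (r∈T , conn , T⊆S) (x∈S , near) →
                     p⊆p∪q _ r∈T , connected-near conn near , ∪-least T⊆S (⁅⁆⊆ x∈S))
                  (x∈⁅x⁆ r , connected-⁅⁆ r , ⁅⁆⊆ r∈S)
  ... | T , (r∈T , conn , T⊆S) , closed =
    T , conn , T⊆S , λ x∈S near → closed (x∈S , near-mono (⁅⁆⊆ r∈T) near)

  -- Vertices of `S` not near `I` are added while there are any. A remaining one would lie in `I` by
  -- saturation, hence be near `I` after all.
  maximalIndependent : ∀ S → ∃ λ I → I ⊆ S × Independent G I × (∀ {x} → x ∈ S → Near I x)
  maximalIndependent S
    with saturate {P = λ I → I ⊆ S × Independent G I} {R = λ I x → x ∈ S × ¬ Near I x}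
                  (λ I x → x ∈? S ×-dec ¬? (near? I x))
                  (λ (I⊆S , ind) (x∈S , ¬near) → ∪-least I⊆S (⁅⁆⊆ x∈S) , add ind ¬near)
                  ((λ x∈ → contradiction x∈ ∉⊥) , λ u v u∈ → contradiction u∈ ∉⊥)
    where
    add : ∀ {I x} → Independent G I → ¬ Near I x → Independent G (I ∪ ⁅ x ⁆)
    add {I} {x} ind ¬near u v u∈ v∈ u~v with x∈p∪q⁻ I ⁅ x ⁆ u∈ | x∈p∪q⁻ I ⁅ x ⁆ v∈
    ... | inj₁ u∈I | inj₁ v∈I = ind u v u∈I v∈I u~v
    ... | inj₁ u∈I | inj₂ v∈x rewrite x∈⁅y⁆⇒x≡y x v∈x = ¬near (inj₂ (u , u∈I , u~v))
    ... | inj₂ u∈x | inj₁ v∈I rewrite x∈⁅y⁆⇒x≡y x u∈x = ¬near (inj₂ (v , v∈I , ~-sym u~v))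
    ... | inj₂ u∈x | inj₂ v∈x
      rewrite x∈⁅y⁆⇒x≡y x u∈x | x∈⁅y⁆⇒x≡y x v∈x = ~-irrefl u~v
  ... | I , (I⊆S , ind) , max = I , I⊆S , ind , λ {x} x∈S →
    decidable-stable (near? I x) (λ ¬near → ¬near (inj₁ (max (x∈S , ¬near))))

  -- Extending colorings

  -- Only neighbors of `w` are constrained, so `w` may already lie in `S` and is then recolored.
  proper-extend : ∀ {S c k w} → Proper G S c → (∀ {x} → x ∈ S → x ~ w → c x ≢ k) →
                  Proper G (S ∪ ⁅ w ⁆) (updateAt c w (const k))
  proper-extend {S} {c} {k} p avoid u v u∈ v∈ u~v eq
    with updateAt-∪⁅⁆ {S = S} {c} {k} u∈ | updateAt-∪⁅⁆ {S = S} {c} {k} v∈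
  ... | inj₁ (refl , _)  | inj₁ (refl , _)  = ~-irrefl u~v
  ... | inj₁ (refl , u≡) | inj₂ (v∈S , v≡)  =
    avoid v∈S (~-sym u~v) (trans (sym v≡) (trans (sym eq) u≡))
  ... | inj₂ (u∈S , u≡)  | inj₁ (refl , v≡) = avoid u∈S u~v (trans (sym u≡) (trans eq v≡))
  ... | inj₂ (u∈S , u≡)  | inj₂ (v∈S , v≡)  =
    p u v u∈S v∈S u~v (trans (sym u≡) (trans eq v≡))

  bounded-extend : ∀ {S} {c : Coloring n} {k w q} → (∀ {x} → x ∈ S → c x < q) → k < q →
                   ∀ {x} → x ∈ S ∪ ⁅ w ⁆ → updateAt c w (const k) x < q
  bounded-extend {S} {c} {k} b k<q x∈ with updateAt-∪⁅⁆ {S = S} {c} {k} x∈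
  ... | inj₁ (_ , eq)   = subst (_< _) (sym eq) k<q
  ... | inj₂ (x∈S , eq) = subst (_< _) (sym eq) (b x∈S)

  Colorable-near : ∀ {S q} w → Colorable S q → Colorable (S ∪ ⁅ w ⁆) (suc q)
  Colorable-near {q = q} w (c , p , b) =
    updateAt c w (const q) , proper-extend p (λ x∈ _ → <⇒≢ (b x∈))
    , bounded-extend (m<n⇒m<1+n ∘ b) (n<1+n q)

  -- Without neighbors in `S`, the vertex `w` can take any old color; 0 is one because `q` is
  -- positive.
  Colorable-far : ∀ {S q w} → 0 < q → ¬ Near S w → Colorable S q → Colorable (S ∪ ⁅ w ⁆) q
  Colorable-far {w = w} 0<q ¬near (c , p , b) =
    updateAt c w (const 0)
    , proper-extend p (λ x∈ x~w → contradiction (inj₂ (_ , x∈ , x~w)) ¬near)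
    , bounded-extend b 0<q

  -- On Y the color 0 is replaced by the new color q; then u may take q and v may take 0.
  Colorable-bridge : ∀ {X Y q u v} → 0 < q → ¬ Near Y u → ¬ Near X v →
                     Colorable (X ∪ Y) q → Colorable ((X ∪ Y) ∪ ⁅ u ⁆ ∪ ⁅ v ⁆) (suc q)
  Colorable-bridge {X} {Y} {q} {u} {v} 0<q u-far v-far (c , p , b) =
    Colorable-anti
      (∪-least (p⊆p∪q ⁅ v ⁆ ∘ p⊆p∪q ⁅ u ⁆)
               (∪-least (p⊆p∪q ⁅ v ⁆ ∘ q⊆p∪q (X ∪ Y) ⁅ u ⁆) (q⊆p∪q ((X ∪ Y) ∪ ⁅ u ⁆) ⁅ v ⁆)))
      ( updateAt e v (const 0)
      , proper-extend (proper-extend d-proper u-avoids) v-avoids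
      , bounded-extend (bounded-extend d-bounded (n<1+n q)) z<s)
    where
    d : Coloring n
    d x with x ∈? Y ×-dec c x ≟ 0
    ... | yes _ = q
    ... | no  _ = c x
    e = updateAt d u (const q)
    d-proper : Proper G (X ∪ Y) d
    d-proper x y x∈ y∈ x~y with x ∈? Y ×-dec c x ≟ 0 | y ∈? Y ×-dec c y ≟ 0
    ... | yes (_ , cx≡0) | yes (_ , cy≡0) = λ _ → p x y x∈ y∈ x~y (trans cx≡0 (sym cy≡0))
    ... | yes _          | no _           = <⇒≢ (b y∈) ∘ sym
    ... | no _           | yes _          = <⇒≢ (b x∈)
    ... | no _           | no _           = p x y x∈ y∈ x~y
    d-bounded : ∀ {x} → x ∈ X ∪ Y → d x < suc q
    d-bounded {x} x∈ with x ∈? Y ×-dec c x ≟ 0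
    ... | yes _ = n<1+n q
    ... | no  _ = m<n⇒m<1+n (b x∈)
    -- Old colors are below `q`, so under `d` the color `q` occurs only in `Y`, away from `u`.
    u-avoids : ∀ {x} → x ∈ X ∪ Y → x ~ u → d x ≢ q
    u-avoids {x} x∈ x~u with x ∈? Y ×-dec c x ≟ 0
    ... | yes (x∈Y , _) = contradiction (inj₂ (x , x∈Y , x~u)) u-far
    ... | no _          = <⇒≢ (b x∈)
    -- Under `d` the color 0 survives only outside `Y`, hence in `X`, away from `v`.
    d-nonzero : ∀ {x} → x ∈ X ∪ Y → x ~ v → d x ≢ 0
    d-nonzero {x} x∈ x~v with x ∈? Y ×-dec c x ≟ 0 | x∈p∪q⁻ X Y x∈
    ... | yes _ | _        = <⇒≢ 0<q ∘ sym
    ... | no _  | inj₁ x∈X = contradiction (inj₂ (x , x∈X , x~v)) v-far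
    ... | no ¬z | inj₂ x∈Y = λ cx≡0 → ¬z (x∈Y , cx≡0)
    -- The remaining possible neighbor of `v` is `u`, whose color `q` is not 0.
    v-avoids : ∀ {x} → x ∈ (X ∪ Y) ∪ ⁅ u ⁆ → x ~ v → e x ≢ 0
    v-avoids x∈ x~v ex≡0 with updateAt-∪⁅⁆ {S = X ∪ Y} {d} {q} x∈
    ... | inj₁ (_ , eq)   = <⇒≢ 0<q (trans (sym ex≡0) eq)
    ... | inj₂ (x∈H , eq) = d-nonzero x∈H x~v (trans (sym eq) ex≡0)

  -- Each added vertex is far from the current set, so `Colorable-far` keeps the bound `q`.
  -- Saturation leaves no far vertex.
  dominatingSuperset : ∀ {S q} → 0 < q → Colorable S q →
                       ∃ λ T → S ⊆ T × Dominating T × Colorable T q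
  dominatingSuperset {S} {q} 0<q S-col
    with saturate {P = λ T → S ⊆ T × Colorable T q} {R = λ T x → ¬ Near T x}
                  (λ T x → ¬? (near? T x))
                  (λ (S⊆T , col) far → p⊆p∪q _ ∘ S⊆T , Colorable-far 0<q far col)
                  ((λ x∈ → x∈) , S-col)
  ... | T , (S⊆T , col) , max = T , S⊆T
    , (λ x → decidable-stable (near? T x) (λ far → far (inj₁ (max far)))) , col

  -- Merging connected pieces

  -- The walk is followed while `P` holds. Either `Q` is met on the way, or the walk leaves `P`
  -- along an edge whose first end is outside `Q`.
  crossing : ∀ {P Q : Fin n → Set} → (∀ x → Dec (P x)) → (∀ x → Dec (Q x)) →
             ∀ {x y} → Star _~_ x y → P x → Q y →
             (∃ λ w → P w × Q w) ⊎ (∃₂ λ u v → u ~ v × P u × ¬ Q u × ¬ P v)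
  crossing P? Q? {x} xs px qy with Q? x
  crossing P? Q? xs         px qy | yes qx = inj₁ (_ , px , qx)
  crossing P? Q? ε          px qy | no ¬qx = contradiction qy ¬qx
  crossing P? Q? (x~z ◅ zs) px qy | no ¬qx with P? _
  ... | yes pz = crossing P? Q? zs pz qy
  ... | no ¬pz = inj₂ (_ , _ , x~z , px , ¬qx , ¬pz)

  module _ (G-conn : Connected G ⊤) where

    -- `crossing` is applied to nearness to `X` and to `Y`. A common near vertex is paid for by
    -- `Colorable-near`, a crossing edge by `Colorable-bridge`; both cost one color.
    link : ∀ {X Y q} → Connected G X → Nonempty Y → Dominating (X ∪ Y) → Colorable (X ∪ Y) q →
           ∃₂ λ X′ w → Connected G X′ × X ⊆ X′ × w ∈ X′ × Near Y w × Colorable (X′ ∪ Y) (suc q)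
    link {X} {Y} {q} X-conn (y , y∈Y) dom col@(c , _ , b)
      with crossing (near? X) (near? Y)
             (Star.map (proj₂ ∘ proj₂) (proj₂ G-conn x y ∈⊤ ∈⊤)) (inj₁ x∈X) (inj₁ y∈Y)
      where
      x = proj₁ (proj₁ X-conn)
      x∈X = proj₂ (proj₁ X-conn)
    ... | inj₁ (w , w-X , w-Y) = X ∪ ⁅ w ⁆ , w
      , connected-near X-conn w-X , p⊆p∪q _ , q⊆p∪q X _ (x∈⁅x⁆ w) , w-Y
      , Colorable-anti
          (∪-least (∪-least (p⊆p∪q _ ∘ p⊆p∪q Y) (q⊆p∪q (X ∪ Y) _)) (p⊆p∪q _ ∘ q⊆p∪q X Y))
          (Colorable-near w col)
    ... | inj₂ (u , v , u~v , u-X , u-far , v-far) = (X ∪ ⁅ u ⁆) ∪ ⁅ v ⁆ , v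
      , connected-near (connected-near X-conn u-X) (inj₂ (u , q⊆p∪q X _ (x∈⁅x⁆ u) , u~v))
      , p⊆p∪q _ ∘ p⊆p∪q _ , q⊆p∪q (X ∪ ⁅ u ⁆) _ (x∈⁅x⁆ v) , v-Y
      , Colorable-anti
          (∪-least (∪-least (∪-least (p⊆p∪q _ ∘ p⊆p∪q Y) (q⊆p∪q (X ∪ Y) _ ∘ p⊆p∪q _))
                            (q⊆p∪q (X ∪ Y) _ ∘ q⊆p∪q ⁅ u ⁆ _))
                   (p⊆p∪q _ ∘ q⊆p∪q X Y))
          (Colorable-bridge 0<q u-far v-far col)
      where
      0<q : 0 < q
      0<q = ≤-<-trans z≤n (b (q⊆p∪q X Y y∈Y))
      -- Domination makes `v` near `X` or `Y`, and `X` is excluded.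
      v-Y : Near Y v
      v-Y = [ (λ v-X → contradiction v-X v-far) , (λ n → n) ]′ (near-∪⁻ (dom v))
        where
        near-∪⁻ : ∀ {x} → Near (X ∪ Y) x → Near X x ⊎ Near Y x
        near-∪⁻ (inj₁ x∈) = [ inj₁ ∘ inj₁ , inj₂ ∘ inj₁ ]′ (x∈p∪q⁻ X Y x∈)
        near-∪⁻ (inj₂ (z , z∈ , z~x)) =
          [ (λ z∈X → inj₁ (inj₂ (z , z∈X , z~x))) , (λ z∈Y → inj₂ (inj₂ (z , z∈Y , z~x))) ]′
            (x∈p∪q⁻ X Y z∈)

    -- Each round absorbs one piece of `Ts` into the first piece for one color. The induction is on
    -- the number `m` of remaining pieces, as the absorbed piece may sit anywhere in `Ts`. Pieces
    -- may overlap.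
    merge : ∀ m {q} T Ts → length Ts ≡ m → Connected G T → (∀ {S} → S ∈ᴸ Ts → Connected G S) →
            Dominating (⋃ (T ∷ Ts)) → Colorable (⋃ (T ∷ Ts)) q →
            ∃ λ S → Connected G S × ⋃ (T ∷ Ts) ⊆ S × Colorable S (q + m)
    merge zero {q} T [] refl T-conn _ _ col =
      T , T-conn , ∪-least (λ x∈ → x∈) (λ x∈ → contradiction x∈ ∉⊥)
      , subst (Colorable T) (+-comm 0 q) (Colorable-anti (p⊆p∪q _) col)
    merge (suc m) {q} T Ts@(T₁ ∷ _) len T-conn Ts-conn dom col
      with link T-conn (let x , x∈ = proj₁ (Ts-conn (here refl)) in x , p⊆p∪q _ x∈) dom col
    ... | X , w , X-conn , T⊆X , w∈X , w-Ts , col′ with near-⋃⁻ Ts w-Ts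
    ...   | U , U∈ , w-U with ∈-∃++ U∈
    ...     | as , bs , split =
      let S , S-conn , ⊆S , S-col = merge m {suc q} X′ (as ++ bs) len′ X′-conn rest-conn dom′ col″
      in S , S-conn , ⊆S ∘ grown , subst (Colorable S) (sym (+-suc q m)) S-col
      where
      -- `U` extended by `w` is connected and meets `X` in `w`. As `w` is already in `X`, this
      -- second addition costs no color.
      X′ = X ∪ (U ∪ ⁅ w ⁆)
      X′-conn : Connected G X′
      X′-conn = connected-∪ X-conn (connected-near (Ts-conn U∈) w-U) w∈X (q⊆p∪q U _ (x∈⁅x⁆ w))
      rest⊆ : ∀ {S} → S ∈ᴸ as ++ bs → S ∈ᴸ Ts
      rest⊆ S∈ = subst (_ ∈ᴸ_) (sym split) (∈-++-∷⁺ as S∈)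
      rest-conn : ∀ {S} → S ∈ᴸ as ++ bs → Connected G S
      rest-conn = Ts-conn ∘ rest⊆
      grown : ⋃ (T ∷ Ts) ⊆ ⋃ (X′ ∷ as ++ bs)
      grown = ∪-least (p⊆p∪q _ ∘ p⊆p∪q _ ∘ T⊆X) λ x∈ →
        let V , V∈ , x∈V = x∈⋃⁻ Ts x∈ in
        [ (λ { refl → p⊆p∪q _ (q⊆p∪q X _ (p⊆p∪q _ x∈V)) })
        , (λ V∈rest → x∈⋃⁺ (there V∈rest) x∈V) ]′ (∈-++-∷⁻ as (subst (V ∈ᴸ_) split V∈))
      dom′ : Dominating (⋃ (X′ ∷ as ++ bs))
      dom′ = near-mono grown ∘ dom
      col″ : Colorable (⋃ (X′ ∷ as ++ bs)) (suc q)
      col″ = Colorable-anti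
        (∪-least (∪-least (p⊆p∪q _)
                          (∪-least (q⊆p∪q X _ ∘ x∈⋃⁺ U∈) (⁅⁆⊆ (p⊆p∪q _ w∈X))))
                 (λ x∈ → let V , V∈ , x∈V = x∈⋃⁻ (as ++ bs) x∈ in
                         q⊆p∪q X _ (x∈⋃⁺ (rest⊆ V∈) x∈V)))
        col′
      len′ : length (as ++ bs) ≡ m
      len′ = suc-injective
        (trans (sym (length-++-sucʳ as U bs)) (trans (cong length (sym split)) len))

    -- A dominating superset `D` keeps the bound `q`. A maximal independent set `r ∷ rs` of `D`
    -- gives one component per vertex, possibly with repetitions; merging them takes `length rs`
    -- rounds.
    connectedSuperset : ∀ {a S q} → (∀ {I} → Independent G I → ∣ I ∣ ≤ a) →
                        Nonempty S → Colorable S q →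
                        ∃ λ T → Connected G T × S ⊆ T × Colorable T (q + (a ∸ 1))
    connectedSuperset {S = S} _ (s , s∈S) S-col@(_ , _ , bounded)
      with dominatingSuperset (≤-<-trans z≤n (bounded s∈S)) S-col
    ... | D , S⊆D , D-dom , D-col with maximalIndependent D
    ...   | I , I⊆D , I-ind , I-max with elements I
    -- `I` cannot be empty: it dominates `D`, which contains `s`.
    ...     | [] , _ , I⊆[] , _ with I-max (S⊆D s∈S)
    ...       | inj₁ s∈I           = contradiction (I⊆[] s∈I) λ ()
    ...       | inj₂ (_ , x∈I , _) = contradiction (I⊆[] x∈I) λ ()
    connectedSuperset {a} {S} {q} α≤a _ _
      | D , S⊆D , D-dom , D-col | I , I⊆D , I-ind , I-max | r ∷ rs , len , I⊆rs , rs⊆I =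
      let T , T-conn , ⊆T , c , p , b = merge (length rs) (piece r) (map piece rs)
                                          (length-map piece rs) (piece-conn r) pieces-conn
                                          (near-mono D⊆ ∘ D-dom) (Colorable-anti ⊆D D-col)
      in T , T-conn , ⊆T ∘ D⊆ ∘ S⊆D
         -- `length rs` is `length (r ∷ rs) ∸ 1` by computation.
         , c , p , λ x∈ → <-≤-trans (b x∈) (+-monoʳ-≤ q (∸-monoˡ-≤ 1 rs≤a))
      where
      piece : Fin n → Subset n
      piece x with x ∈? D
      ... | yes x∈D = proj₁ (component D x∈D)
      -- A connected default outside `D` makes `piece` total, so that it can be mapped over a list.
      ... | no _    = ⁅ x ⁆
      piece-conn : ∀ x → Connected G (piece x)
      piece-conn x with x ∈? D
      ... | yes x∈D = proj₁ (proj₂ (component D x∈D))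
      ... | no _    = connected-⁅⁆ x
      piece⊆D : ∀ {x} → x ∈ I → piece x ⊆ D
      piece⊆D {x} x∈I with x ∈? D
      ... | yes x∈D = proj₁ (proj₂ (proj₂ (component D x∈D)))
      ... | no x∉D  = contradiction (I⊆D x∈I) x∉D
      pieces-conn : ∀ {U} → U ∈ᴸ map piece rs → Connected G U
      pieces-conn U∈ with ∈-map⁻ piece U∈
      ... | x , _ , refl = piece-conn x
      near⇒∈piece : ∀ {x y} → x ∈ I → y ∈ D → Near ⁅ x ⁆ y → y ∈ piece x
      near⇒∈piece {x} x∈I with x ∈? D
      ... | yes x∈D = proj₂ (proj₂ (proj₂ (component D x∈D)))
      ... | no x∉D  = contradiction (I⊆D x∈I) x∉D
      D⊆ : D ⊆ ⋃ (map piece (r ∷ rs))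
      D⊆ y∈D with I-max y∈D
      ... | inj₁ y∈I = x∈⋃⁺ (∈-map⁺ piece (I⊆rs y∈I)) (near⇒∈piece y∈I y∈D (inj₁ (x∈⁅x⁆ _)))
      ... | inj₂ (x , x∈I , x~y) =
        x∈⋃⁺ (∈-map⁺ piece (I⊆rs x∈I)) (near⇒∈piece x∈I y∈D (inj₂ (x , x∈⁅x⁆ x , x~y)))
      ⊆D : ⋃ (map piece (r ∷ rs)) ⊆ D
      ⊆D y∈ with x∈⋃⁻ (map piece (r ∷ rs)) y∈
      ... | U , U∈ , y∈U with ∈-map⁻ piece U∈
      ...   | x , x∈ , refl = piece⊆D (rs⊆I x∈) y∈U
      rs≤a : length (r ∷ rs) ≤ a
      rs≤a = ≤-trans (≤-reflexive len) (α≤a I-ind)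

    -- Passing to the connected superset loses no color of `c` and raises `χ` by at most `α G ∸ 1`.
    excess-connected : ∀ c {S} → Nonempty S →
                       ∃ λ T → Connected G T × excess G c S ≤ excess G c T + (α G ∸ 1)
    excess-connected c {S} S≠∅ =
      let T , T-conn , S⊆T , T-col =
            connectedSuperset (Maximum.greatest (α-max G)) S≠∅ (χ-Colorable S)
      in T , T-conn , bound (#colors-mono c S⊆T) (Colorable⇒χ≤ T-col)
      where
      -- Truncation is harmless: `t` is at most `y + (t ∸ y)` even when `t` is below `y`.
      bound : ∀ {s t x y a} → s ≤ t → y ≤ x + a → s ∸ x ≤ t ∸ y + a
      bound {s} {t} {x} {y} {a} s≤t y≤x+a = m≤n+o⇒m∸n≤o s x (begin
        s                   ≤⟨ s≤t ⟩
        t                   ≤⟨ m≤n+m∸n t y ⟩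
        y + (t ∸ y)         ≤⟨ +-monoˡ-≤ (t ∸ y) y≤x+a ⟩
        x + a + (t ∸ y)     ≡⟨ +-assoc x a (t ∸ y) ⟩
        x + (a + (t ∸ y))   ≡⟨ cong (x +_) (+-comm a (t ∸ y)) ⟩
        x + (t ∸ y + a)     ∎)
        where open ≤-Reasoning

    -- Positivity, witnessed by a single vertex, lets the truncated `∸ 1` be moved from `α G` to the
    -- whole sum.
    0<α : 0 < α G
    0<α = ≤-trans (≤-reflexive (sym (∣⁅x⁆∣≡1 x))) (Maximum.greatest (α-max G) ⁅x⁆-ind)
      where
      x = proj₁ (proj₁ G-conn)
      ⁅x⁆-ind : Independent G ⁅ x ⁆
      ⁅x⁆-ind u v u∈ v∈ u~v =
        ~-irrefl (subst (u ~_) (trans (x∈⁅y⁆⇒x≡y x v∈) (sym (x∈⁅y⁆⇒x≡y x u∈))) u~v)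

-- Comparing minima and maxima

module _ {X : Set} {P : X → Set} {f : X → ℕ} where

  -- The minimizer of `g` is a competitor in the minimum of `f`.
  minimum-bound : ∀ {g a} (A : Minimum P f) (B : Minimum P g) → 0 < a →
                  (∀ x → f x ≤ g x + (a ∸ 1)) → Minimum.value A ≤ Minimum.value B + a ∸ 1
  minimum-bound {g} {a} A B 0<a f≤ = begin
    f (Minimum.arg A)             ≤⟨ Minimum.least A (Minimum.arg∈ B) ⟩
    f (Minimum.arg B)             ≤⟨ f≤ (Minimum.arg B) ⟩
    g (Minimum.arg B) + (a ∸ 1)   ≡⟨ +-∸-assoc (g (Minimum.arg B)) 0<a ⟨
    g (Minimum.arg B) + a ∸ 1     ∎
    where open ≤-Reasoning

  maximum-bound : ∀ {Q : X → Set} {k} (A : Maximum P f) (B : Maximum Q f) →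
                  (∀ {x} → P x → ∃ λ y → Q y × f x ≤ f y + k) →
                  Maximum.value A ≤ Maximum.value B + k
  maximum-bound {k = k} A B better with better (Maximum.arg∈ A)
  ... | y , q , f≤ = ≤-trans f≤ (+-monoˡ-≤ k (Maximum.greatest B q))

theorem6p1 : ∀ {n : ℕ} .⦃ _ : NonZero n ⦄ (G : Graph n) → Connected G ⊤ → φ G ≤ φ̂ G + α G ∸ 1
-- The instance is passed explicitly because leaving it to be inferred makes Agda unfold φ and φ̂.
theorem6p1 ⦃ n≢0 ⦄ G G-conn =
  minimum-bound (φ-min G ⦃ n≢0 ⦄) (φ̂-min G ⦃ n≢0 ⦄) (0<α G G-conn) λ c →
    maximum-bound (φ-max G ⦃ n≢0 ⦄ c) (φ̂-max G ⦃ n≢0 ⦄ c) (excess-connected G G-conn c)
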